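{- Let $n\ge1$, $k\in[n]$, $u\in\mathfrak S_n$, and let $\eta\in\mathfrak S_n$ be an $(m+1)$-cycle with $m\ge1$ such that $u\le_k u\eta$. Then there is a unique unimodal path $\gamma$ from $u$ to $u\eta$ in the $k$-Bruhat graph. Moreover $\gamma$ has length $m$ and $\mathrm{de}(\gamma)=\mathrm{ht}_k(\eta)$.
   Context: Bruhat graph: $u\xrightarrow{\tau}w$ if $w=ut_{ab}$ for a transposition with $a<b$, $u(a)<u(b)$, $\tau=u(a)$; a $k$-edge if $a\le k<b$; $u\le_k w$ iff there is a path of $k$-edges from $u$ to $w$. A path with labels $\tau_1,\dots,\tau_m$ is unimodal if $\tau_1<\cdots<\tau_i>\cdots>\tau_m$ for some $1\le i\le m$; then $\mathrm{de}(\gamma)=m-i$. $\mathrm{ht}_k(\eta)=\#\{i\le k:\eta(i)\ne i\}-1$. -}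

module Defs where

open import Data.Nat using (ℕ; zero; suc; _+_; _<_; _≤_; _>_)
open import Data.Fin using (Fin; toℕ; _≟_)
open import Data.Fin.Permutation using (Permutation′; _⟨$⟩ʳ_)
open import Data.List using (List; []; _∷_; _++_; _∷ʳ_; length)
open import Data.List.Relation.Unary.Linked using (Linked)
open import Data.Product using (Σ; _×_; _,_; ∃)
open import Relation.Binary.PropositionalEquality using (_≡_; _≢_)
open import Relation.Nullary using (¬_; yes; no)
import Data.Nat
import Data.Nat.Properties
import Data.Fin
import Data.Fin.Properties
import Data.List
import Data.Product
import Relation.Nullary

-- Positions and values are 0-indexed: Fin n = {0,…,n-1} stands for [n] = {1,…,n},
-- position i : Fin n standing for i+1.  The parameter k : ℕ is the paper's k ∈ [n].

-- A vertex of the Bruhat graph, viewed as a function (one-line notation).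
Vert : ℕ → Set
Vert n = Fin n → Fin n

perm : ∀ {n} → Permutation′ n → Vert n
perm π i = π ⟨$⟩ʳ i

_·_ : ∀ {n} → Permutation′ n → Permutation′ n → Vert n
(u · η) i = u ⟨$⟩ʳ (η ⟨$⟩ʳ i)

swapAt : ∀ {n} → Vert n → Fin n → Fin n → Vert n
swapAt u a b i with i ≟ a
... | yes _ = u b
... | no _ with i ≟ b
...   | yes _ = u a
...   | no _ = u i

-- A step is a pair (a , b) of positions, meaning the edge u → u t_ab.
Step : ℕ → Set
Step n = Fin n × Fin n

-- k-edge u --τ--> u t_ab : a < b, u(a) < u(b), a ≤ k < b (1-indexed),
-- i.e. toℕ a < k ≤ toℕ b with 0-indexed positions.
KEdge : ∀ {n} → ℕ → Vert n → Step n → Set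
KEdge k u (a , b) = (toℕ a < toℕ b) × (toℕ (u a) < toℕ (u b)) × (toℕ a < k) × (k ≤ toℕ b)

-- A path of k-edges from u to w, given by its sequence of steps
-- (this determines and is determined by the sequence of vertices).
data KPath {n : ℕ} (k : ℕ) : Vert n → Vert n → List (Step n) → Set where
  done : ∀ {u w} → (∀ i → u i ≡ w i) → KPath k u w []
  step : ∀ {u w s ss} → KEdge k u s →
         KPath k (swapAt u (Data.Product.proj₁ s) (Data.Product.proj₂ s)) w ss →
         KPath k u w (s ∷ ss)

_≤[_]_ : ∀ {n} → Vert n → ℕ → Vert n → Set
u ≤[ k ] w = ∃ λ γ → KPath k u w γ

-- labels τ_j = u_j(a_j) of a path starting at u (1-indexed values shifted to 0-indexed; order preserved)
labels : ∀ {n} → Vert n → List (Step n) → List ℕ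
labels u [] = []
labels u ((a , b) ∷ ss) = toℕ (u a) ∷ labels (swapAt u a b) ss

UnimodalDe : List ℕ → ℕ → Set
UnimodalDe τ d = Σ (List ℕ) λ xs → Σ ℕ λ x → Σ (List ℕ) λ ys →
  (τ ≡ xs ++ (x ∷ ys)) × Linked _<_ (xs ∷ʳ x) × Linked _>_ (x ∷ ys) × (d ≡ length ys)

Unimodal : List ℕ → Set
Unimodal τ = ∃ λ d → UnimodalDe τ d

UnimodalPath : ∀ {n} → ℕ → Vert n → Vert n → List (Step n) → Set
UnimodalPath k u w γ = KPath k u w γ × Unimodal (labels u γ)

next : ∀ {ℓ} → Fin ℓ → Fin ℓ
next {suc ℓ} i with Data.Nat._≟_ (suc (toℕ i)) (suc ℓ)
... | yes _ = Data.Fin.zero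
... | no ne = Data.Fin.fromℕ< (Data.Nat.Properties.≤∧≢⇒< (Data.Fin.Properties.toℕ<n i) ne)

IsCycle : ∀ {n} → Permutation′ n → ℕ → Set
IsCycle {n} η ℓ = Σ (Fin ℓ → Fin n) λ c →
  (∀ i j → c i ≡ c j → i ≡ j) ×
  (∀ i → η ⟨$⟩ʳ c i ≡ c (next i)) ×
  (∀ x → (∀ i → c i ≢ x) → η ⟨$⟩ʳ x ≡ x)

-- #{ i ≤ k : η(i) ≠ i }  (1-indexed), i.e. #{ i : toℕ i < k, η(i) ≠ i }
movedUpTo : ∀ {n} → Permutation′ n → ℕ → ℕ
movedUpTo {n} η k = Data.List.length
  (Data.List.filter (λ i → Data.Nat._<?_ (toℕ i) k Relation.Nullary.×-dec
                           Relation.Nullary.¬? ((η ⟨$⟩ʳ i) ≟ i))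
     (Data.List.allFin n))

{-# OPTIONS --safe #-}
-- View u as a row of values, each held by a low (≤ k) or a high position: a k-edge exchanges a
-- low position with a high position of larger value, so low positions only ascend and high ones
-- only descend, and positions fixed by η never take part.  Let p hold the least value v moved by
-- the cycle, and let z be the position with (uη)(z) = v.  On any path v is the label of exactly one
-- step, the step (p , z), and every other label exceeds v; in a unimodal path that step is hence
-- the first or the last.  Removing it cuts z, respectively p, out of the cycle.  By monotonicity
-- the first option is possible only if u(z) < (uη)(p) and the last only if (uη)(p) < u(z), so one
-- inducts on the length of the cycle.  A last step adds a descent and removes a low position.

module Submission where

open import Defs
open import Data.Nat using (ℕ; zero; suc; _+_; _≤_; _<_; _>_; _<?_) renaming (_≟_ to _≟ℕ_)
open import Data.Nat.Properties using (<-asym; <-≤-trans; ≤-trans; ≤-reflexive; ≤-refl; ≰⇒>; ≤⇒≯; ≤-antisym; ≤∧≢⇒<; ≮⇒≥; <⇒≤; <⇒≱; <⇒≢; <-cmp; suc-injective; +-comm)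
open import Data.Fin using (Fin; zero; suc; toℕ; fromℕ; inject₁; _≟_)
open import Data.Fin.Properties using (toℕ-injective; toℕ<n; toℕ-fromℕ; toℕ-fromℕ<; toℕ-inject₁; toℕ-inject₁-≢)
open import Data.Fin.Permutation using (Permutation′; _⟨$⟩ʳ_; inverseˡ; _⟨$⟩ˡ_)
open import Data.List using (List; []; _∷_; _++_; _∷ʳ_; [_]; length; filter; tabulate; allFin)
open import Data.List.Properties using (length-++; length-tabulate; filter-accept; filter-reject)
open import Data.List.Extrema.Nat using (argmin; argmin-sel; f[argmin]≤f[⊤]; f[argmin]≤f[xs])
open import Data.List.Membership.Propositional using (_∈_; _∉_)
open import Data.List.Membership.Propositional.Properties using (∈-∃++; ∈-filter⁺; ∈-filter⁻; ∈-allFin; ∈-tabulate⁺; ∈-tabulate⁻)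
open import Data.List.Membership.Propositional.Properties.WithK using (unique∧set⇒bag)
open import Data.List.Relation.Binary.BagAndSetEquality using (∼bag⇒↭)
open import Data.List.Relation.Binary.Permutation.Propositional using (_↭_; ↭-refl; ↭-sym; ↭⇒↭ₛ)
open import Data.List.Relation.Binary.Permutation.Propositional.Properties using (∈-resp-↭; ↭-length; filter-↭; ++-comm)
open import Data.List.Relation.Unary.All as All using (All; []; _∷_)
open import Data.List.Relation.Unary.Any using (here; there)
open import Data.List.Relation.Unary.AllPairs as AllPairs using ([]; _∷_)
open import Data.List.Relation.Unary.Linked using (Linked; []; [-]; _∷_)
open import Data.List.Relation.Unary.Unique.Propositional using (Unique)
open import Data.List.Relation.Unary.Unique.Propositional.Properties using (filter⁺; allFin⁺; tabulate⁺)
open import Data.Product using (Σ; ∃; ∃₂; _×_; _,_; proj₁; proj₂)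
open import Data.Sum using (_⊎_; inj₁; inj₂)
open import Function using (_∘_)
open import Function.Bundles using (mk⇔)
open import Function.Definitions using (Injective)
open import Relation.Binary.Definitions using (tri<; tri≈; tri>)
open import Relation.Binary.PropositionalEquality using (_≡_; _≢_; _≗_; refl; sym; trans; cong; subst; setoid)
open import Relation.Nullary using (¬_; ¬?; _×-dec_; Dec; yes; no; contradiction; decidable-stable)
import Data.List.Membership.DecPropositional as DecMembership
import Data.List.Relation.Binary.Permutation.Setoid.Properties as PermutationSetoid

private
  variable
    n k m c d v : ℕ
    u u′ w w′ : Vert n
    a b i j p q z : Fin n
    xs : List (Fin n)
    γ : List (Step n)
    τ : List ℕ

-- Unimodal label sequences

-- An inductive form of `UnimodalDe`, suited to adding and removing labels at either end; the index
-- counts the labels after the peak.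
data Uni : List ℕ → ℕ → Set where
  peak : ∀ {x ys} → Linked _>_ (x ∷ ys) → Uni (x ∷ ys) (length ys)
  rise : ∀ {x y zs d} → x < y → Uni (y ∷ zs) d → Uni (x ∷ y ∷ zs) d

UnimodalDe⇒Uni : UnimodalDe τ d → Uni τ d
UnimodalDe⇒Uni (xs , x , ys , refl , up , down , refl) = go xs up
  where
  go : ∀ xs → Linked _<_ (xs ∷ʳ x) → Uni (xs ++ x ∷ ys) (length ys)
  go []           _         = peak down
  go (_ ∷ [])     (a<x ∷ l) = rise a<x (go [] l)
  go (_ ∷ b ∷ xs) (a<b ∷ l) = rise a<b (go (b ∷ xs) l)

Uni⇒UnimodalDe : Uni τ d → UnimodalDe τ d
Uni⇒UnimodalDe (peak down) = [] , _ , _ , refl , [-] , down , refl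
Uni⇒UnimodalDe (rise x<y r) with Uni⇒UnimodalDe r
... | []     , x , ys , refl , up , down , eq = _ ∷ [] , x , ys , refl , x<y ∷ up , down , eq
... | b ∷ xs , x , ys , refl , up , down , eq = _ ∷ b ∷ xs , x , ys , refl , x<y ∷ up , down , eq

Uni-functional : ∀ {d′} → Uni τ d → Uni τ d′ → d ≡ d′
Uni-functional (peak _)         (peak _)         = refl
Uni-functional (peak (x>y ∷ _)) (rise x<y _)     = contradiction x<y (<-asym x>y)
Uni-functional (rise x<y _)     (peak (x>y ∷ _)) = contradiction x<y (<-asym x>y)
Uni-functional (rise _ r)       (rise _ r′)      = Uni-functional r r′

Uni-cons : All (v <_) τ → Uni τ d → Uni (v ∷ τ) d
Uni-cons {τ = _ ∷ _} (v<y ∷ _) r = rise v<y r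

Uni-uncons : ∀ {y ys} → v < y → Uni (v ∷ y ∷ ys) d → Uni (y ∷ ys) d
Uni-uncons v<y (peak (v>y ∷ _)) = contradiction v<y (<-asym v>y)
Uni-uncons v<y (rise _ r)       = r

-- A label below all others extends the falling part, which accounts for the extra descent.
Uni-snoc : All (v <_) τ → Uni τ d → Uni (τ ∷ʳ v) (suc d)
Uni-snoc {v} low (peak {x} {ys} down) =
  subst (Uni _) (trans (length-++ ys) (+-comm _ 1)) (peak (go ys low down))
  where
  go : ∀ {x} ys → All (v <_) (x ∷ ys) → Linked _>_ (x ∷ ys) → Linked _>_ (x ∷ ys ∷ʳ v)
  go []       (v<x ∷ _) _         = v<x ∷ [-]
  go (_ ∷ ys) (_ ∷ low) (x>y ∷ l) = x>y ∷ go ys low l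
Uni-snoc (_ ∷ low) (rise x<y r) = rise x<y (Uni-snoc low r)

-- The number of descents is left open: it drops by one unless the removed label was itself the
-- peak.
Uni-unsnoc : ∀ {x} xs → Uni (x ∷ xs ∷ʳ v) d → ∃ (Uni (x ∷ xs))
Uni-unsnoc [] _ = _ , peak [-]
Uni-unsnoc {v} xs@(_ ∷ _) (peak l) = _ , peak (go xs l)
  where
  go : ∀ {x} xs → Linked _>_ (x ∷ xs ∷ʳ v) → Linked _>_ (x ∷ xs)
  go []       _         = [-]
  go (_ ∷ xs) (x>y ∷ l) = x>y ∷ go xs l
Uni-unsnoc (_ ∷ xs) (rise x<y r) with _ , r′ ← Uni-unsnoc xs r = _ , rise x<y r′

-- Stripping leading labels brings `v` to second place, where the labels fall to `v` and then rise
-- again; neither constructor allows this.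
Uni-no-valley : ∀ {x xs y ys} → All (v <_) (x ∷ xs) → v < y → ¬ Uni (x ∷ xs ++ v ∷ y ∷ ys) d
Uni-no-valley {xs = []}    _           v<y (peak (_ ∷ v>y ∷ _)) = <-asym v<y v>y
Uni-no-valley {xs = []}    (v<x ∷ _)   _   (rise x<v _)         = <-asym v<x x<v
Uni-no-valley {xs = _ ∷ _} (_ ∷ low)   v<y (peak (_ ∷ l))       = Uni-no-valley low v<y (peak l)
Uni-no-valley {xs = _ ∷ _} (_ ∷ low)   v<y (rise _ r)           = Uni-no-valley low v<y r

-- Swaps

-- The motive sees a position and its new value but not the swap, so pointwise claims about swaps
-- reduce to three cases.
swapAt-elim : (P : Fin n → Fin n → Set) → P a (u b) → P b (u a) →
              (∀ i → i ≢ a → i ≢ b → P i (u i)) → ∀ i → P i (swapAt u a b i)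
swapAt-elim {a = a} {b = b} P pa pb po i with i ≟ a
... | yes refl = pa
... | no i≢a with i ≟ b
...   | yes refl = pb
...   | no i≢b = po i i≢a i≢b

swapAt-left : ∀ (u : Vert n) a b → swapAt u a b a ≡ u b
swapAt-left u a b with a ≟ a
... | yes _ = refl
... | no a≢a = contradiction refl a≢a

swapAt-right : ∀ (u : Vert n) a b → swapAt u a b b ≡ u a
swapAt-right u a b with b ≟ a
... | yes refl = refl
... | no _ with b ≟ b
...   | yes _ = refl
...   | no b≢b = contradiction refl b≢b

swapAt-other : ∀ (u : Vert n) {a b i} → i ≢ a → i ≢ b → swapAt u a b i ≡ u i
swapAt-other u {a} {b} {i} i≢a i≢b with i ≟ a
... | yes i≡a = contradiction i≡a i≢a
... | no _ with i ≟ b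
...   | yes i≡b = contradiction i≡b i≢b
...   | no _ = refl

swapAt-cong : u ≗ w → ∀ a b → swapAt u a b ≗ swapAt w a b
swapAt-cong {w = w} u≗w a b = swapAt-elim (λ i x → x ≡ swapAt w a b i)
  (trans (u≗w b) (sym (swapAt-left w a b)))
  (trans (u≗w a) (sym (swapAt-right w a b)))
  (λ i i≢a i≢b → trans (u≗w i) (sym (swapAt-other w i≢a i≢b)))

swapAt-involutive : ∀ (u : Vert n) a b → swapAt (swapAt u a b) a b ≗ u
swapAt-involutive u a b = swapAt-elim (λ i x → x ≡ u i)
  (swapAt-right u a b) (swapAt-left u a b) (λ i → swapAt-other u)

swapAt-id : ∀ (u : Vert n) a b → swapAt u a b ≗ u ∘ swapAt (λ i → i) a b
swapAt-id u a b i with i ≟ a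
... | yes _ = refl
... | no _ with i ≟ b
...   | yes _ = refl
...   | no _ = refl

swapAt-injective : ∀ a b → Injective _≡_ _≡_ u → Injective _≡_ _≡_ (swapAt u a b)
swapAt-injective {u = u} a b inj {i} {j} eq =
  trans (sym (involutive i)) (trans (cong σ σi≡σj) (involutive j))
  where
  σ = swapAt (λ i → i) a b
  involutive : ∀ i → σ (σ i) ≡ i
  involutive i = trans (sym (swapAt-id σ a b i)) (swapAt-involutive (λ i → i) a b i)
  σi≡σj = inj (trans (sym (swapAt-id u a b i)) (trans eq (swapAt-id u a b j)))

-- Paths of k-edges

-- A consequence of `u ≤[ k ] w`, and the form in which the induction carries that hypothesis.
Mono : ℕ → Vert n → Vert n → Set
Mono k u w = ∀ i → (toℕ i < k → toℕ (u i) ≤ toℕ (w i)) × (k ≤ toℕ i → toℕ (w i) ≤ toℕ (u i))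

Mono-trans : Mono k u u′ → Mono k u′ w → Mono k u w
Mono-trans f g i = (λ lo → ≤-trans (proj₁ (f i) lo) (proj₁ (g i) lo))
                 , (λ hi → ≤-trans (proj₂ (g i) hi) (proj₂ (f i) hi))

-- Each position moves in one direction only, so it cannot leave a value and return to it.
Mono-squeeze : Mono k u u′ → Mono k u′ w → u i ≡ w i → u′ i ≡ w i
Mono-squeeze {k = k} {i = i} f g eq with toℕ i <? k
... | yes lo = toℕ-injective (≤-antisym (proj₁ (g i) lo)
                 (≤-trans (≤-reflexive (cong toℕ (sym eq))) (proj₁ (f i) lo)))
... | no ¬lo = toℕ-injective (≤-antisym
                 (≤-trans (proj₂ (f i) (≮⇒≥ ¬lo)) (≤-reflexive (cong toℕ eq)))
                 (proj₂ (g i) (≮⇒≥ ¬lo)))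

KEdge-mono : KEdge k u (a , b) → Mono k u (swapAt u a b)
KEdge-mono {k = k} {u = u} (_ , ua<ub , a<k , k≤b) = swapAt-elim
  (λ i x → (toℕ i < k → toℕ (u i) ≤ toℕ x) × (k ≤ toℕ i → toℕ x ≤ toℕ (u i)))
  ((λ _ → <⇒≤ ua<ub) , (λ k≤a → contradiction k≤a (<⇒≱ a<k)))
  ((λ b<k → contradiction k≤b (<⇒≱ b<k)) , (λ _ → <⇒≤ ua<ub))
  (λ _ _ _ → (λ _ → ≤-refl) , (λ _ → ≤-refl))

KPath-mono : KPath k u w γ → Mono k u w
KPath-mono (done u≗w) i = (λ _ → ≤-reflexive (cong toℕ (u≗w i)))
                        , (λ _ → ≤-reflexive (cong toℕ (sym (u≗w i))))
KPath-mono {u = u} {w = w} (step e π) = Mono-trans {u = u} {w = w} (KEdge-mono e) (KPath-mono π)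

KEdge-moves-left : KEdge k u (a , b) → Mono k (swapAt u a b) w → u a ≢ w a
KEdge-moves-left {u = u} {a = a} {b = b} {w = w} e@(_ , ua<ub , _) f eq =
  <⇒≢ ua<ub (cong toℕ (trans eq (sym
    (trans (sym (swapAt-left u a b)) (Mono-squeeze {u = u} {w = w} (KEdge-mono e) f eq)))))

KEdge-moves-right : KEdge k u (a , b) → Mono k (swapAt u a b) w → u b ≢ w b
KEdge-moves-right {u = u} {a = a} {b = b} {w = w} e@(_ , ua<ub , _) f eq =
  <⇒≢ ua<ub (cong toℕ (trans
    (trans (sym (swapAt-right u a b)) (Mono-squeeze {u = u} {w = w} (KEdge-mono e) f eq)) (sym eq)))

KPath-trivial : u ≗ w → KPath k u w γ → γ ≡ []
KPath-trivial u≗w (done _) = refl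
KPath-trivial {w = w} u≗w (step {s = a , _} e π) =
  contradiction (u≗w a) (KEdge-moves-left {w = w} e (KPath-mono π))

-- Each label is the value at a moved position. Both ends of a step are moved, so exchanging their
-- values preserves the bound.
labels-above : (∀ i → u i ≢ w i → v < toℕ (u i)) → KPath k u w γ → All (v <_) (labels u γ)
labels-above above (done _) = []
labels-above {w = w} {v = v} above (step {s = a , b} e π) =
  above a ma ∷ labels-above
    (swapAt-elim (λ i x → x ≢ w i → v < toℕ x) (λ _ → above b mb) (λ _ → above a ma) (λ i _ _ → above i)) π
  where
  ma = KEdge-moves-left {w = w} e (KPath-mono π)
  mb = KEdge-moves-right {w = w} e (KPath-mono π)

run : Vert n → List (Step n) → Vert n
run u []            = u
run u ((a , b) ∷ γ) = run (swapAt u a b) γ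

labels-++ : ∀ (u : Vert n) γ₁ γ₂ → labels u (γ₁ ++ γ₂) ≡ labels u γ₁ ++ labels (run u γ₁) γ₂
labels-++ u []             γ₂ = refl
labels-++ u ((a , b) ∷ γ₁) γ₂ = cong (toℕ (u a) ∷_) (labels-++ (swapAt u a b) γ₁ γ₂)

KPath-run : KPath k u w γ → run u γ ≗ w
KPath-run (done u≗w) = u≗w
KPath-run (step _ π) = KPath-run π

KPath-split : ∀ γ₁ {γ₂} → KPath k u w (γ₁ ++ γ₂) → KPath k u (run u γ₁) γ₁ × KPath k (run u γ₁) w γ₂
KPath-split []       π          = done (λ _ → refl) , π
KPath-split (_ ∷ γ₁) (step e π) with π₁ , π₂ ← KPath-split γ₁ π = step e π₁ , π₂

KPath-end : w ≗ w′ → KPath k u w γ → KPath k u w′ γ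
KPath-end w≗w′ (done u≗w) = done (λ i → trans (u≗w i) (w≗w′ i))
KPath-end w≗w′ (step e π) = step e (KPath-end w≗w′ π)

KPath-snoc : KPath k u w γ → KEdge k w (a , b) → KPath k u (swapAt w a b) (γ ∷ʳ (a , b))
KPath-snoc {a = a} {b = b} (done u≗w) (a<b , wa<wb , lo , hi)
  rewrite sym (u≗w a) | sym (u≗w b) = step (a<b , wa<wb , lo , hi) (done (swapAt-cong u≗w a b))
KPath-snoc (step e′ π) e = step e′ (KPath-snoc π e)

-- The step creating the minimal label

-- All that the analysis of paths needs from the cycle. The cycle itself is not mentioned, so the
-- data survive steps that avoid `p`.
record MinSwap {n} (k : ℕ) (u w : Vert n) (p z : Fin n) : Set where
  field
    u-injective : Injective _≡_ _≡_ u
    w-injective : Injective _≡_ _≡_ w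
    p-low       : toℕ p < k
    z-high      : k ≤ toℕ z
    p-moved     : u p ≢ w p
    z-target    : w z ≡ u p
    u-min       : ∀ i → u i ≢ w i → toℕ (u p) ≤ toℕ (u i)
    w-min       : ∀ i → u i ≢ w i → toℕ (u p) ≤ toℕ (w i)

  u-min-strict : i ≢ p → u i ≢ w i → toℕ (u p) < toℕ (u i)
  u-min-strict i≢p moved = ≤∧≢⇒< (u-min _ moved) (i≢p ∘ sym ∘ u-injective ∘ toℕ-injective)

module _ (S : MinSwap k u w p z) where
  open MinSwap S

  private
    z≢p : z ≢ p
    z≢p refl = contradiction z-high (<⇒≱ p-low)

    p<z : toℕ p < toℕ z
    p<z = <-≤-trans p-low z-high

    up<uz : toℕ (u p) < toℕ (u z)
    up<uz = u-min-strict z≢p (λ eq → z≢p (u-injective (trans eq z-target)))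

    up<wp : toℕ (u p) < toℕ (w p)
    up<wp = ≤∧≢⇒< (w-min p p-moved) (p-moved ∘ toℕ-injective)

  MinSwap-edge : KEdge k u (p , z)
  MinSwap-edge = p<z , up<uz , p-low , z-high

  above-after-MinSwap : ∀ i → swapAt u p z i ≢ w i → toℕ (u p) < toℕ (swapAt u p z i)
  above-after-MinSwap = swapAt-elim (λ i x → x ≢ w i → toℕ (u p) < toℕ x)
    (λ _ → up<uz) (λ up≢wz → contradiction (sym z-target) up≢wz) (λ _ i≢p _ → u-min-strict i≢p)

  MinSwap-last-edge : KEdge k (swapAt w p z) (p , z)
  MinSwap-last-edge rewrite swapAt-left w p z | swapAt-right w p z | z-target =
    p<z , up<wp , p-low , z-high

  -- With the target changed to `swapAt w p z`, the position `p` ends with `w z`, which is `u p`,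
  -- and so counts as fixed.
  above-before-MinSwap : ∀ i → u i ≢ swapAt w p z i → toℕ (u p) < toℕ (u i)
  above-before-MinSwap = swapAt-elim (λ i x → u i ≢ x → toℕ (u p) < toℕ (u i))
    (λ up≢wz → contradiction (sym z-target) up≢wz) (λ _ → up<uz) (λ _ i≢p _ → u-min-strict i≢p)

  -- After the step the high position `b` holds the least moved value and can only descend, so it
  -- keeps it to the end; `z` is the position that ends with it.
  MinSwap-partner : KEdge k u (p , b) → Mono k (swapAt u p b) w → b ≡ z
  MinSwap-partner {b = b} e@(_ , _ , _ , k≤b) f = w-injective (trans (toℕ-injective (≤-antisym
    (subst (λ x → toℕ (w b) ≤ toℕ x) (swapAt-right u p b) (proj₂ (f b) k≤b))
    (w-min b (KEdge-moves-right {w = w} e f)))) (sym z-target))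

  MinSwap-keeps : KEdge k u (a , b) → a ≢ p → swapAt u a b p ≡ u p
  MinSwap-keeps {a = a} {b = b} (_ , _ , _ , k≤b) a≢p = swapAt-other u (a≢p ∘ sym) p≢b
    where
    p≢b : p ≢ b
    p≢b refl = contradiction k≤b (<⇒≱ p-low)

  -- Both `a` and `b` are moved, so exchanging their values keeps `u p` minimal; a position still to
  -- be moved was to be moved before, by `Mono-squeeze`.
  MinSwap-after : KEdge k u (a , b) → a ≢ p → Mono k (swapAt u a b) w → MinSwap k (swapAt u a b) w p z
  MinSwap-after {a = a} {b = b} e a≢p f = record
    { u-injective = swapAt-injective a b u-injective
    ; w-injective = w-injective
    ; p-low       = p-low
    ; z-high      = z-high
    ; p-moved     = p-moved ∘ trans (sym tp≡up)
    ; z-target    = trans z-target (sym tp≡up)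
    ; u-min       = subst (λ x → ∀ i → t i ≢ w i → toℕ x ≤ toℕ (t i)) (sym tp≡up)
        (swapAt-elim (λ i x → x ≢ w i → toℕ (u p) ≤ toℕ x)
          (λ _ → u-min b (KEdge-moves-right {w = w} e f))
          (λ _ → u-min a (KEdge-moves-left {w = w} e f))
          (λ i _ _ → u-min i))
    ; w-min       = λ i moved → subst (λ x → toℕ x ≤ toℕ (w i)) (sym tp≡up)
        (w-min i (moved ∘ Mono-squeeze {u = u} {w = w} (KEdge-mono e) f))
    }
    where
    t = swapAt u a b
    tp≡up : t p ≡ u p
    tp≡up = MinSwap-keeps e a≢p

-- Some step must use `p`, and the first that does is `(p , z)`. Earlier labels are values at other
-- moved positions; afterwards the least value rests at its target `z`.
MinSwap-occurs : MinSwap k u w p z → KPath k u w γ →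
  ∃₂ λ γ₁ γ₂ → γ ≡ γ₁ ++ (p , z) ∷ γ₂ × run u γ₁ p ≡ u p ×
    All (toℕ (u p) <_) (labels u γ₁) ×
    All (toℕ (u p) <_) (labels (swapAt (run u γ₁) p z) γ₂)
MinSwap-occurs S (done u≗w) = contradiction (u≗w _) (MinSwap.p-moved S)
MinSwap-occurs {w = w} {p = p} S (step {s = a , b} {ss = γ} e π) with a ≟ p
... | yes refl with refl ← MinSwap-partner S e (KPath-mono π) =
  [] , γ , refl , refl , [] , labels-above (above-after-MinSwap S) π
... | no a≢p with MinSwap-occurs (MinSwap-after S e a≢p (KPath-mono π)) π
...   | γ₁ , γ₂ , refl , run≡ , low₁ , low₂ rewrite MinSwap-keeps S e a≢p =
  (a , b) ∷ γ₁ , γ₂ , refl , run≡ ,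
  MinSwap.u-min-strict S a≢p (KEdge-moves-left {w = w} e (KPath-mono π)) ∷ low₁ , low₂

-- `Uni` holds of no empty sequence, hence the alternative `γ′ ≡ []`.
FirstOrLast : ℕ → Vert n → Vert n → Fin n → Fin n → List (Step n) → Set
FirstOrLast k u w p z γ =
  (∃ λ γ′ → γ ≡ (p , z) ∷ γ′ × KPath k (swapAt u p z) w γ′ ×
    (γ′ ≡ [] ⊎ ∃ (Uni (labels (swapAt u p z) γ′)))) ⊎
  (∃ λ γ′ → γ ≡ γ′ ∷ʳ (p , z) × KPath k u (swapAt w p z) γ′ ×
    (γ′ ≡ [] ⊎ ∃ (Uni (labels u γ′))))

-- A label occurring once and below all others cannot be interior to a unimodal sequence.
MinSwap-first-or-last : MinSwap k u w p z → KPath k u w γ → Uni (labels u γ) d → FirstOrLast k u w p z γ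
MinSwap-first-or-last {u = u} {w = w} {p = p} {z = z} {d = d} S π r with MinSwap-occurs S π
... | [] , [] , refl , _ , _ , _ with step _ π′ ← π = inj₁ (_ , refl , π′ , inj₁ refl)
... | [] , _ ∷ _ , refl , _ , _ , v<y ∷ _ with step _ π′ ← π =
  inj₁ (_ , refl , π′ , inj₂ (_ , Uni-uncons v<y r))
... | γ₁@(_ ∷ γ₁′) , [] , refl , run≡ , _ , _ with KPath-split γ₁ π
...   | π₁ , step _ (done eq) = inj₂ (γ₁ , refl , KPath-end end π₁ , inj₂ (Uni-unsnoc (labels _ γ₁′)
          (subst (λ τ → Uni τ d) (labels-++ u γ₁ _) r)))
  where
  end : run u γ₁ ≗ swapAt w p z
  end i = trans (sym (swapAt-involutive (run u γ₁) p z i)) (swapAt-cong eq p z i)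
MinSwap-first-or-last {u = u} {p = p} {z = z} {d = d} S π r
    | γ₁@(_ ∷ _) , γ₂@(_ ∷ _) , refl , run≡ , low₁ , v<y ∷ _ =
  contradiction (subst (λ τ → Uni τ d) labels≡ r) (Uni-no-valley low₁ v<y)
  where
  labels≡ : labels u (γ₁ ++ (p , z) ∷ γ₂) ≡
            labels u γ₁ ++ toℕ (u p) ∷ labels (swapAt (run u γ₁) p z) γ₂
  labels≡ = trans (labels-++ u γ₁ _) (cong (λ x → labels u γ₁ ++ toℕ x ∷ labels (swapAt (run u γ₁) p z) γ₂) run≡)

-- Existence and uniqueness through one reduction

record Solution {n} (k : ℕ) (u w : Vert n) (m c : ℕ) : Set where
  field
    path      : List (Step n)
    isPath    : KPath k u w path
    length≡   : length path ≡ m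
    de        : ℕ
    unimodal  : Uni (labels u path) de
    -- `c` will be the number of low positions on the cycle, which is the height plus one.
    suc-de    : suc de ≡ c
    unique    : ∀ {γ d} → KPath k u w γ → Uni (labels u γ) d → γ ≡ path

Solution-single : MinSwap k u w p z → swapAt u p z ≗ w → Solution k u w 1 1
Solution-single {u = u} {w = w} {p = p} {z = z} S eq = record
  { path     = [ p , z ]
  ; isPath   = step (MinSwap-edge S) (done eq)
  ; length≡  = refl
  ; de       = 0
  ; unimodal = peak [-]
  ; suc-de   = refl
  ; unique   = λ π r → unique (MinSwap-first-or-last S π r)
  }
  where
  unique : ∀ {γ} → FirstOrLast _ u w p z γ → γ ≡ _
  unique (inj₁ (_ , refl , π , _)) = cong ((p , z) ∷_) (KPath-trivial eq π)
  unique (inj₂ (_ , refl , π , _)) = cong (_∷ʳ (p , z)) (KPath-trivial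
    (λ i → trans (sym (swapAt-involutive u p z i)) (swapAt-cong eq p z i)) π)

-- With `(p , z)` last, the earlier steps would take the high position `z` from `u z` up to `w p`,
-- which is impossible. With `(p , z)` first, an empty remainder would force `u z` to equal `w p`.
Solution-first : MinSwap k u w p z → toℕ (u z) < toℕ (w p) →
  Solution k (swapAt u p z) w m c → Solution k u w (suc m) c
Solution-first {u = u} {w = w} {p = p} {z = z} S uz<wp R = record
  { path     = (p , z) ∷ path
  ; isPath   = step (MinSwap-edge S) isPath
  ; length≡  = cong suc length≡
  ; de       = de
  ; unimodal = Uni-cons (labels-above (above-after-MinSwap S) isPath) unimodal
  ; suc-de   = suc-de
  ; unique   = λ π r → unique′ (MinSwap-first-or-last S π r)
  }
  where
  open Solution R
  open MinSwap S using (z-high)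
  unique′ : ∀ {γ} → FirstOrLast _ u w p z γ → γ ≡ _
  unique′ (inj₁ (_ , refl , π , inj₂ (_ , r)))       = cong ((p , z) ∷_) (unique π r)
  unique′ (inj₁ (_ , refl , done eq , inj₁ refl))    = contradiction
    (trans (sym (swapAt-left u p z)) (eq p)) (<⇒≢ uz<wp ∘ cong toℕ)
  unique′ (inj₂ (_ , refl , π , _))                  = contradiction
    (subst (λ x → toℕ x ≤ toℕ (u z)) (swapAt-right w p z) (proj₂ (KPath-mono π z) z-high)) (<⇒≱ uz<wp)

-- Dually, with `(p , z)` first the low position `p` would have to come down from `u z` to `w p`.
Solution-last : MinSwap k u w p z → toℕ (w p) < toℕ (u z) →
  Solution k u (swapAt w p z) m c → Solution k u w (suc m) (suc c)
Solution-last {u = u} {w = w} {p = p} {z = z} S wp<uz R = record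
  { path     = path ∷ʳ (p , z)
  ; isPath   = KPath-end (swapAt-involutive w p z) (KPath-snoc isPath (MinSwap-last-edge S))
  ; length≡  = trans (length-++ path) (trans (+-comm _ 1) (cong suc length≡))
  ; de       = suc de
  ; unimodal = subst (λ τ → Uni τ _) labels≡
      (Uni-snoc (labels-above (above-before-MinSwap S) isPath) unimodal)
  ; suc-de   = cong suc suc-de
  ; unique   = λ π r → unique′ (MinSwap-first-or-last S π r)
  }
  where
  open Solution R
  open MinSwap S using (p-low; z-target)
  labels≡ : labels u path ∷ʳ toℕ (u p) ≡ labels u (path ∷ʳ (p , z))
  -- The last step starts where `path` ends, and there `p` holds `w z`, which is `u p`.
  labels≡ = trans
    (cong (λ x → labels u path ∷ʳ toℕ x)
      (sym (trans (KPath-run isPath p) (trans (swapAt-left w p z) z-target))))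
    (sym (labels-++ u path _))
  unique′ : ∀ {γ} → FirstOrLast _ u w p z γ → γ ≡ _
  unique′ (inj₁ (_ , refl , π , _))                  = contradiction
    (subst (λ x → toℕ x ≤ toℕ (w p)) (swapAt-left u p z) (proj₁ (KPath-mono π p) p-low)) (<⇒≱ wp<uz)
  unique′ (inj₂ (_ , refl , π , inj₂ (_ , r)))       = cong (_∷ʳ (p , z)) (unique π r)
  unique′ (inj₂ (_ , refl , done eq , inj₁ refl))    = contradiction
    (sym (trans (eq z) (swapAt-right w p z))) (<⇒≢ wp<uz ∘ cong toℕ)

-- Cyclic lists of positions

-- For `w` equal to `u · η` this says that `η` sends each position to the next. Stated through `u`
-- and `w`, it can be followed while either of them is swapped.
Chain : Vert n → Vert n → Fin n → List (Fin n) → Fin n → Set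
Chain u w p []       q = w p ≡ u q
Chain u w p (x ∷ xs) q = w p ≡ u x × Chain u w x xs q

Chain-++⁺ : ∀ xs {ys} → Chain u w p xs q → Chain u w q ys z → Chain u w p (xs ++ q ∷ ys) z
Chain-++⁺ []       e       c′ = e , c′
Chain-++⁺ (_ ∷ xs) (e , c) c′ = e , Chain-++⁺ xs c c′

Chain-++⁻ : ∀ xs {ys} → Chain u w p (xs ++ q ∷ ys) z → Chain u w p xs q × Chain u w q ys z
Chain-++⁻ []       c       = c
Chain-++⁻ (_ ∷ xs) (e , c) with c₁ , c₂ ← Chain-++⁻ xs c = (e , c₁) , c₂

-- The first position enters only through `w` and the last only through `u`, so both may be replaced
-- by other positions.
Chain-cong : ∀ {p′ q′} xs → w p ≡ w′ p′ → (∀ {i} → i ∈ xs → w i ≡ w′ i) →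
             (∀ {i} → i ∈ xs → u i ≡ u′ i) → u q ≡ u′ q′ →
             Chain u w p xs q → Chain u′ w′ p′ xs q′
Chain-cong []       wp ws us uq e       = trans (sym wp) (trans e uq)
Chain-cong (_ ∷ xs) wp ws us uq (e , c) =
  trans (sym wp) (trans e (us (here refl))) ,
  Chain-cong xs (ws (here refl)) (ws ∘ there) (us ∘ there) uq c

-- Along a chain the values of `w` are those of `u`, shifted by one place.
Chain-lower : ∀ xs → Chain u w p xs q → (∀ {i} → i ∈ p ∷ xs → v ≤ toℕ (w i)) →
              ∀ {i} → i ∈ q ∷ xs → v ≤ toℕ (u i)
Chain-lower []       e       low (here refl)         = subst (λ x → _ ≤ toℕ x) e (low (here refl))
Chain-lower (_ ∷ xs) (e , c) low (here refl)         = Chain-lower xs c (low ∘ there) (here refl)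
Chain-lower (_ ∷ xs) (e , c) low (there (here refl)) = subst (λ x → _ ≤ toℕ x) e (low (here refl))
Chain-lower (_ ∷ xs) (e , c) low (there (there i∈))  = Chain-lower xs c (low ∘ there) (there i∈)

Chain-tabulate : ∀ (f : Fin (suc m) → Fin n) → (∀ i → w (f (inject₁ i)) ≡ u (f (suc i))) →
                 w (f (fromℕ m)) ≡ u q → Chain u w (f zero) (tabulate (f ∘ suc)) q
Chain-tabulate {m = zero}  f link last = last
Chain-tabulate {m = suc _} f link last = link zero , Chain-tabulate (f ∘ suc) (link ∘ suc) last

record Cycle {n} (u w : Vert n) (p : Fin n) (xs : List (Fin n)) : Set where
  field
    chain    : Chain u w p xs p
    distinct : Unique (p ∷ xs)
    fixed    : ∀ i → i ∉ p ∷ xs → u i ≡ w i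

  moved⇒∈ : ∀ i → u i ≢ w i → i ∈ p ∷ xs
  moved⇒∈ i moved = decidable-stable (i ∈? p ∷ xs) (moved ∘ fixed i)
    where open DecMembership _≟_ using (_∈?_)

Cycle-rotate : Cycle u w p xs → z ∈ p ∷ xs → ∃ λ ys → Cycle u w z ys × p ∷ xs ↭ z ∷ ys
Cycle-rotate {p = p} {z = z} C z∈ with ∈-∃++ z∈
... | []     , ys , refl = ys , C , ↭-refl
... | _ ∷ xs , ys , refl = ys ++ p ∷ xs , C′ , σ
  where
  open Cycle C
  σ = ++-comm (p ∷ xs) (z ∷ ys)
  C′ = record
    { chain    = Chain-++⁺ ys (proj₂ (Chain-++⁻ xs chain)) (proj₁ (Chain-++⁻ xs chain))
    ; distinct = PermutationSetoid.Unique-resp-↭ (setoid _) (↭⇒↭ₛ σ) distinct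
    ; fixed    = λ i i∉ → fixed i (i∉ ∘ ∈-resp-↭ σ)
    }

-- The swap gives `z` its final value and moves `u z` to `p`, so the predecessor of `z` now leads to
-- `p`.
Cycle-drop-z : Cycle u w z (p ∷ xs) → Cycle (swapAt u p z) w p xs
Cycle-drop-z {u = u} {w = w} {z = z} {p = p} {xs = xs}
  record { chain = e , c ; distinct = (_ ∷ z∉) ∷ distinct@(p∉ ∷ _) ; fixed = fixed } = record
  { chain    = Chain-cong xs refl (λ _ → refl)
      (λ i∈ → sym (swapAt-other u (All.lookup p∉ i∈ ∘ sym) (All.lookup z∉ i∈ ∘ sym)))
      (sym (swapAt-left u p z)) c
  ; distinct = distinct
  ; fixed    = swapAt-elim (λ i x → i ∉ p ∷ xs → x ≡ w i)
      (λ p∉ → contradiction (here refl) p∉) (λ _ → sym e)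
      (λ { i _ i≢z i∉ → fixed i λ { (here i≡z) → i≢z i≡z ; (there i∈) → i∉ i∈ } })
  }

-- The swapped target leaves `p` its own value and gives `w p` to `z`, so `z` now leads to the
-- successor of `p`.
Cycle-drop-p : Cycle u w z (p ∷ xs) → Cycle u (swapAt w p z) z xs
Cycle-drop-p {u = u} {w = w} {z = z} {p = p} {xs = xs}
  record { chain = e , c ; distinct = (_ ∷ z∉) ∷ p∉ ∷ distinct ; fixed = fixed } = record
  { chain    = Chain-cong xs (sym (swapAt-right w p z))
      (λ i∈ → sym (swapAt-other w (All.lookup p∉ i∈ ∘ sym) (All.lookup z∉ i∈ ∘ sym)))
      (λ _ → refl) refl c
  ; distinct = z∉ ∷ distinct
  ; fixed    = swapAt-elim (λ i x → i ∉ z ∷ xs → u i ≡ x)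
      (λ _ → sym e) (λ z∉ → contradiction (here refl) z∉)
      (λ { i i≢p _ i∉ → fixed i λ { (here i≡z) → i∉ (here i≡z) ; (there (here i≡p)) → i≢p i≡p
                                  ; (there (there i∈)) → i∉ (there i∈) } })
  }

-- A high `p` could only descend from the least value, giving `w p` equal to `w z`; a low `z` could
-- only ascend to it, giving `u z` equal to `u p`. Injectivity excludes both.
Cycle⇒MinSwap : Injective _≡_ _≡_ u → Injective _≡_ _≡_ w → Mono k u w → Cycle u w z (p ∷ xs) →
                (∀ {i} → i ∈ z ∷ p ∷ xs → toℕ (w z) ≤ toℕ (w i)) → MinSwap k u w p z
Cycle⇒MinSwap {u = u} {w = w} {k = k} {z = z} {p = p} {xs = xs} u-inj w-inj mono C low = record
  { u-injective = u-inj
  ; w-injective = w-inj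
  ; p-low       = p-low
  ; z-high      = z-high
  ; p-moved     = λ up≡wp → z≢p (w-inj (trans wz≡up up≡wp))
  ; z-target    = wz≡up
  ; u-min       = λ i → u-low ∘ moved⇒∈ i
  ; w-min       = λ i → subst (λ x → toℕ x ≤ toℕ (w i)) wz≡up ∘ low ∘ moved⇒∈ i
  }
  where
  open Cycle C
  wz≡up : w z ≡ u p
  wz≡up = proj₁ chain
  z≢p : z ≢ p
  z≢p = All.head (AllPairs.head distinct)
  u-low : ∀ {i} → i ∈ z ∷ p ∷ xs → toℕ (u p) ≤ toℕ (u i)
  u-low {i} = subst (λ x → toℕ x ≤ toℕ (u i)) wz≡up ∘ Chain-lower (p ∷ xs) chain low
  p-low : toℕ p < k
  p-low = ≰⇒> λ k≤p → z≢p (w-inj (toℕ-injective (≤-antisym (low (there (here refl)))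
    (subst (λ x → toℕ (w p) ≤ toℕ x) (sym wz≡up) (proj₂ (mono p) k≤p)))))
  z-high : k ≤ toℕ z
  z-high = ≮⇒≥ λ z<k → z≢p (u-inj (toℕ-injective (≤-antisym
    (subst (λ x → toℕ (u z) ≤ toℕ x) wz≡up (proj₁ (mono z) z<k)) (u-low (here refl)))))

-- Induction on the length of the cycle

lowCount : ℕ → List (Fin n) → ℕ
lowCount k xs = length (filter (λ i → toℕ i <? k) xs)

lowCount-low : ∀ (xs : List (Fin n)) → toℕ p < k → lowCount k (p ∷ xs) ≡ suc (lowCount k xs)
lowCount-low xs p<k = cong length (filter-accept (λ i → toℕ i <? _) p<k)

lowCount-high : ∀ (xs : List (Fin n)) → k ≤ toℕ z → lowCount k (z ∷ xs) ≡ lowCount k xs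
lowCount-high xs k≤z = cong length (filter-reject (λ i → toℕ i <? _) (≤⇒≯ k≤z))

solution : ∀ m → Injective _≡_ _≡_ u → Injective _≡_ _≡_ w → Mono k u w → Cycle u w p xs →
           length xs ≡ suc m → Solution k u w (suc m) (lowCount k (p ∷ xs))

-- The case of a cycle listed from `z`, so that `p` comes next. Comparing `u z` with `w p` decides
-- whether `(p , z)` is the first or the last step.
solution-min : ∀ m → Injective _≡_ _≡_ u → Injective _≡_ _≡_ w → Mono k u w → Cycle u w z (p ∷ xs) →
               length xs ≡ m → MinSwap k u w p z → Solution k u w (suc m) (lowCount k (z ∷ p ∷ xs))

solution {u = u} {w = w} {k = k} {p = p} {xs = xs} m u-inj w-inj mono C len
  = go (Cycle-rotate C lowest∈)
  where
  f : _ → ℕ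
  f i = toℕ (w i)
  -- This is `z`: minimizing `w` rather than `u` finds where the least value ends, and the next
  -- entry is where it starts.
  lowest = argmin f p xs
  lowest∈ : lowest ∈ p ∷ xs
  lowest∈ with argmin-sel f p xs
  ... | inj₁ ≡p = here ≡p
  ... | inj₂ ∈xs = there ∈xs
  lowest-min : ∀ {i} → i ∈ p ∷ xs → f lowest ≤ f i
  lowest-min = All.lookup (f[argmin]≤f[⊤] {f = f} p xs ∷ f[argmin]≤f[xs] {f = f} p xs)
  go : (∃ λ ys → Cycle u w lowest ys × p ∷ xs ↭ lowest ∷ ys) → Solution k u w (suc m) (lowCount k (p ∷ xs))
  go (ys , C′ , σ) with trans (sym (suc-injective (↭-length σ))) len
  go (_ ∷ _ , C′ , σ) | len′ =
    subst (Solution k u w (suc m)) (↭-length (filter-↭ (λ i → toℕ i <? k) (↭-sym σ)))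
      (solution-min m u-inj w-inj mono C′ (suc-injective len′)
        (Cycle⇒MinSwap u-inj w-inj mono C′ (lowest-min ∘ ∈-resp-↭ (↭-sym σ))))

solution-min {u = u} {w = w} {k = k} {z = z} {p = p} {xs = []} zero u-inj w-inj mono C refl S =
  subst (Solution k u w 1) (sym (trans (lowCount-high _ z-high) (lowCount-low [] p-low)))
    (Solution-single S u′≗w)
  where
  open MinSwap S
  open Cycle (Cycle-drop-z C)
  -- The remaining cycle is `p` alone, and its chain says that `p` has its final value.
  u′≗w : swapAt u p z ≗ w
  u′≗w i = by-cases (i ≟ p)
    where
    by-cases : Dec (i ≡ p) → swapAt u p z i ≡ w i
    by-cases (yes refl) = sym chain
    by-cases (no i≢p)   = fixed i (λ { (here i≡p) → i≢p i≡p })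
solution-min {u = u} {w = w} {k = k} {z = z} {p = p} {xs = xs@(_ ∷ _)} (suc m) u-inj w-inj mono C len S
  with <-cmp (toℕ (u z)) (toℕ (w p))
... | tri< uz<wp _ _ =
  subst (Solution k u w _) (sym (lowCount-high (p ∷ xs) z-high))
    (Solution-first S uz<wp
      (solution m (swapAt-injective p z u-inj) w-inj mono′ (Cycle-drop-z C) len))
  where
  open MinSwap S
  -- The low position `p` now starts at `u z`, and the comparison lets it ascend to `w p`.
  mono′ : Mono k (swapAt u p z) w
  mono′ = swapAt-elim (λ i x → (toℕ i < k → toℕ x ≤ toℕ (w i)) × (k ≤ toℕ i → toℕ (w i) ≤ toℕ x))
    ((λ _ → <⇒≤ uz<wp) , (λ k≤p → contradiction k≤p (<⇒≱ p-low)))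
    ((λ z<k → contradiction z-high (<⇒≱ z<k)) , (λ _ → ≤-reflexive (cong toℕ z-target)))
    (λ i _ _ → mono i)
-- The cycle has a third position `x` after `p`, with `w p` equal to `u x`; equality would identify
-- `x` with `z`.
... | tri≈ _ uz≡wp _ with record { chain = _ , wp≡ux , _ ; distinct = (_ ∷ z≢x ∷ _) ∷ _ } ← C =
  contradiction (u-inj (trans (toℕ-injective uz≡wp) wp≡ux)) z≢x
... | tri> _ _ wp<uz =
  subst (Solution k u w _)
    -- Removing `p` loses one low position, matching the descent gained; `z` is high and is never
    -- counted.
    (sym (trans (lowCount-high (p ∷ xs) z-high)
         (trans (lowCount-low xs p-low) (cong suc (sym (lowCount-high xs z-high))))))
    (Solution-last S wp<uz
      (solution m u-inj (swapAt-injective p z w-inj) mono′ (Cycle-drop-p C) len))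
  where
  open MinSwap S
  mono′ : Mono k u (swapAt w p z)
  mono′ = swapAt-elim (λ i x → (toℕ i < k → toℕ (u i) ≤ toℕ x) × (k ≤ toℕ i → toℕ x ≤ toℕ (u i)))
    ((λ _ → ≤-reflexive (cong toℕ (sym z-target))) , (λ k≤p → contradiction k≤p (<⇒≱ p-low)))
    ((λ z<k → contradiction z-high (<⇒≱ z<k)) , (λ _ → <⇒≤ wp<uz))
    (λ i _ _ → mono i)

-- Cycles of permutations

next-inject₁ : ∀ (i : Fin m) → next (inject₁ i) ≡ suc i
next-inject₁ {m = m} i with suc (toℕ (inject₁ i)) ≟ℕ suc m
... | yes eq = contradiction (sym (suc-injective eq)) (toℕ-inject₁-≢ i)
... | no ne  = toℕ-injective (trans (toℕ-fromℕ< (≤∧≢⇒< (toℕ<n (inject₁ i)) ne)) (cong suc (toℕ-inject₁ i)))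

next-fromℕ : ∀ m → next (fromℕ m) ≡ zero
next-fromℕ m with suc (toℕ (fromℕ m)) ≟ℕ suc m
... | yes _ = refl
... | no ne = contradiction (cong suc (toℕ-fromℕ m)) ne

next≢ : 1 ≤ m → ∀ (i : Fin (suc m)) → next i ≢ i
next≢ {m = m} 1≤m i with suc (toℕ i) ≟ℕ suc m
... | yes eq = λ { refl → <⇒≢ 1≤m (suc-injective eq) }
... | no ne  = λ eq → <⇒≢ ≤-refl (trans (cong toℕ (sym eq)) (toℕ-fromℕ< (≤∧≢⇒< (toℕ<n i) ne)))

perm-injective : ∀ (π : Permutation′ n) → Injective _≡_ _≡_ (perm π)
perm-injective π eq = trans (sym (inverseˡ π)) (trans (cong (π ⟨$⟩ˡ_) eq) (inverseˡ π))

IsCycle⇒Cycle : (u η : Permutation′ n) (cycle : IsCycle η (suc m)) →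
                Cycle (perm u) (u · η) (proj₁ cycle zero) (tabulate (proj₁ cycle ∘ suc))
IsCycle⇒Cycle {m = m} u η (c , c-inj , η-c , η-fix) = record
  { chain    = Chain-tabulate c
      (λ i → cong (u ⟨$⟩ʳ_) (trans (η-c _) (cong c (next-inject₁ i))))
      (cong (u ⟨$⟩ʳ_) (trans (η-c _) (cong c (next-fromℕ m))))
  ; distinct = tabulate⁺ {f = c} (c-inj _ _)
  ; fixed    = λ i i∉ → cong (u ⟨$⟩ʳ_) (sym (η-fix i (λ { j refl → i∉ (∈-tabulate⁺ {f = c} j) })))
  }

-- Both filtered lists are free of repetitions and have the same members, so they are permutations
-- of each other.
lowCount-movedUpTo : (u η : Permutation′ n) → 1 ≤ m → (cycle : IsCycle η (suc m)) →
                     lowCount k (tabulate (proj₁ cycle)) ≡ movedUpTo η k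
lowCount-movedUpTo {n = n} {k = k} u η 1≤m cycle@(c , c-inj , η-c , _) =
  ↭-length (∼bag⇒↭ (unique∧set⇒bag
    (filter⁺ low? distinct) (filter⁺ moved? (allFin⁺ n)) (mk⇔ to from)))
  where
  open Cycle (IsCycle⇒Cycle u η cycle)
  low? : ∀ i → Dec (toℕ i < k)
  low? i = toℕ i <? k
  moved? : ∀ i → Dec (toℕ i < k × ¬ (η ⟨$⟩ʳ i) ≡ i)
  moved? i = (toℕ i <? k) ×-dec ¬? ((η ⟨$⟩ʳ i) ≟ i)
  to : ∀ {i} → i ∈ filter low? (tabulate c) → i ∈ filter moved? (allFin n)
  to i∈ with i∈c , i<k ← ∈-filter⁻ low? {xs = tabulate c} i∈ with j , refl ← ∈-tabulate⁻ {f = c} i∈c =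
    -- A cycle of length at least two fixes none of its entries.
    ∈-filter⁺ moved? (∈-allFin _) (i<k , λ eq → next≢ 1≤m j (c-inj _ _ (trans (sym (η-c j)) eq)))
  from : ∀ {i} → i ∈ filter moved? (allFin n) → i ∈ filter low? (tabulate c)
  from i∈ with _ , i<k , moved ← ∈-filter⁻ moved? {xs = allFin n} i∈ =
    ∈-filter⁺ low? (moved⇒∈ _ (moved ∘ sym ∘ perm-injective u)) i<k

theorem6p3 : (n k m : ℕ) → 1 ≤ n → 1 ≤ k → k ≤ n →
    (u η : Permutation′ n) → 1 ≤ m → IsCycle η (suc m) →
    perm u ≤[ k ] (u · η) →
    Σ (List (Step n)) λ γ →
    UnimodalPath k (perm u) (u · η) γ ×
    (∀ γ′ → UnimodalPath k (perm u) (u · η) γ′ → γ′ ≡ γ) ×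
    (length γ ≡ m) ×
    (∀ d → UnimodalDe (labels (perm u) γ) d → d + 1 ≡ movedUpTo η k)
theorem6p3 n k (suc m) _ _ _ u η 1≤m cycle@(c , _) (_ , π) =
  path , (isPath , _ , Uni⇒UnimodalDe unimodal) ,
  (λ { γ′ (π′ , _ , r) → unique π′ (UnimodalDe⇒Uni r) }) ,
  length≡ ,
  (λ d r → trans (+-comm d 1) (trans (cong suc (Uni-functional (UnimodalDe⇒Uni r) unimodal))
    (trans suc-de (lowCount-movedUpTo u η 1≤m cycle))))
  where
  -- Here `m` is one less than the path length, and the tail of the cycle has `suc m` entries.
  open Solution (solution m (perm-injective u)
    (perm-injective η ∘ perm-injective u) (KPath-mono π)
    (IsCycle⇒Cycle u η cycle) (length-tabulate (c ∘ suc)))
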